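{- (GBC) The class $V$ of all sets, viewed as the ideal of all subsets of $V$ (i.e. the collection of those subclasses of $V$ that are sets), is a minimal access ideal for $V$.
   Context: GBC is Gödel–Bernays class theory with choice. An ideal on a class (or set) $X$ is a (definable) collection $\mathcal I$ of subclasses of $X$ such that (i) $Y_1,Y_2\in\mathcal I\Rightarrow Y_1\cup Y_2\in\mathcal I$, (ii) $Y\in\mathcal I$, $Z\subseteq Y\Rightarrow Z\in\mathcal I$, (iii) $X\notin\mathcal I$. A preordering of $X$ is a reflexive, transitive, total binary relation $\preccurlyeq$ on $X$; throughout, all preorderings are assumed to have no last element. For $x\in X$ let ${\preccurlyeq_x}=\{y\in X:y\preccurlyeq x\}$. A subclass $Y\subseteq X$ is $\preccurlyeq$-bounded if $Y\subseteq{\preccurlyeq_x}$ for some $x\in X$; otherwise it is cofinal. $Seg(\preccurlyeq)$ denotes the ideal of $\preccurlyeq$-bounded subclasses of $X$. An ideal $\mathcal I$ on $X$ is an access ideal for $X$ ($X$ is $\mathcal I$-accessible) if there is a preordering $\preccurlyeq$ of $X$ with $Seg(\preccurlyeq)\subseteq\mathcal I$; such $\preccurlyeq$ is called an $\mathcal I$-preordering. $\mathcal I$ is a minimal access ideal for $X$ if it is an access ideal for $X$ and for no ideal $\mathcal J\subsetneq\mathcal I$ is $X$ $\mathcal J$-accessible. -}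

module Defs where

open import Level as L using (Level)
open import Data.Nat.Base using (ℕ; suc)
open import Data.Fin.Base using (Fin; zero; suc)
open import Data.Vec.Base using (Vec; []; _∷_; lookup)
open import Data.Product.Base using (∃-syntax; _×_; proj₁)
open import Data.Sum.Base using (_⊎_)
open import Function.Bundles using (_⇔_)
open import Relation.Binary.PropositionalEquality.Core using (_≡_)
open import Relation.Nullary using (¬_; Dec)
open import Relation.Unary using (Pred) renaming (_⊆_ to _⊆ᵖ_; _⊂_ to _⊂ᵖ_)

-- First-order formulas in the language of classes, with de Bruijn variables.
-- All variables range over classes; the quantifiers ∀ˢ and ∃ˢ are restricted
-- to sets.  Predicative formulas, those allowed in class comprehension,
-- quantify over sets only.

data Kind : Set where
  predicative arbitrary : Kind

infix  8 _∈′_ _≐′_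
infix  7 ¬′_
infixr 6 _∧′_
infixr 5 _∨′_
infixr 4 _⇒′_

data Formula : Kind → ℕ → Set where
  _∈′_ _≐′_      : ∀ {k n} → Fin n → Fin n → Formula k n
  ¬′_            : ∀ {k n} → Formula k n → Formula k n
  _∧′_ _∨′_ _⇒′_ : ∀ {k n} → Formula k n → Formula k n → Formula k n
  ∀ˢ ∃ˢ          : ∀ {k n} → Formula k (suc n) → Formula k n
  ∀ᶜ ∃ᶜ          : ∀ {n} → Formula arbitrary (suc n) → Formula arbitrary n

record Structure (ℓ : Level) : Set (L.suc ℓ) where
  infix 4 _∈_
  field
    Class : Set ℓ
    _∈_   : Class → Class → Set ℓ

module Semantics {ℓ : Level} (S : Structure ℓ) where
  open Structure S

  infix 4 _⊆_

  IsSet : Class → Set ℓ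
  IsSet X = ∃[ C ] X ∈ C

  _⊆_ : Class → Class → Set ℓ
  X ⊆ Y = ∀ z → z ∈ X → z ∈ Y

  Sat : ∀ {k n} → Formula k n → Vec Class n → Set ℓ
  Sat (i ∈′ j) ρ = lookup ρ i ∈ lookup ρ j
  Sat (i ≐′ j) ρ = lookup ρ i ≡ lookup ρ j
  Sat (¬′ φ)   ρ = ¬ Sat φ ρ
  Sat (φ ∧′ ψ) ρ = Sat φ ρ × Sat ψ ρ
  Sat (φ ∨′ ψ) ρ = Sat φ ρ ⊎ Sat ψ ρ
  Sat (φ ⇒′ ψ) ρ = Sat φ ρ → Sat ψ ρ
  Sat (∀ˢ φ)   ρ = ∀ x → IsSet x → Sat φ (x ∷ ρ)
  Sat (∃ˢ φ)   ρ = ∃[ x ] IsSet x × Sat φ (x ∷ ρ)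
  Sat (∀ᶜ φ)   ρ = ∀ X → Sat φ (X ∷ ρ)
  Sat (∃ᶜ φ)   ρ = ∃[ X ] Sat φ (X ∷ ρ)

  IsPair : Class → Class → Class → Set ℓ
  IsPair p x y = ∀ w → w ∈ p ⇔ (w ≡ x ⊎ w ≡ y)

  -- Kuratowski: p = {{x},{x,y}}
  IsOrderedPair : Class → Class → Class → Set ℓ
  IsOrderedPair p x y =
    ∃[ a ] ∃[ b ] IsPair a x x × IsPair b x y × IsPair p a b

  ⟨_,_⟩∈_ : Class → Class → Class → Set ℓ
  ⟨ x , y ⟩∈ R = ∃[ p ] IsOrderedPair p x y × p ∈ R

  Functional : Class → Set ℓ
  Functional F = ∀ x y z → ⟨ x , y ⟩∈ F → ⟨ x , z ⟩∈ F → y ≡ z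

  IsEmpty : Class → Set ℓ
  IsEmpty X = ∀ z → ¬ z ∈ X

-- Models of Gödel–Bernays class theory with global choice.  Sets are the
-- classes that are members of some class.
record GBC (ℓ : Level) : Set (L.suc ℓ) where
  field
    structure : Structure ℓ
  open Structure structure public
  open Semantics structure public
  field
    -- The theory is formulated in classical logic, so every formula of its
    -- language is either true or false in the model.
    excludedMiddle : ∀ {k n} (φ : Formula k n) (ρ : Vec Class n) → Dec (Sat φ ρ)

    extensionality : ∀ X Y → (∀ z → z ∈ X ⇔ z ∈ Y) → X ≡ Y

    comprehension : ∀ {n} (φ : Formula predicative (suc n)) (ρ : Vec Class n) →
      ∃[ C ] (∀ x → x ∈ C ⇔ (IsSet x × Sat φ (x ∷ ρ)))

    pairing : ∀ x y → IsSet x → IsSet y → ∃[ p ] IsSet p × IsPair p x y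

    union : ∀ x → IsSet x →
      ∃[ u ] IsSet u × (∀ z → z ∈ u ⇔ (∃[ y ] z ∈ y × y ∈ x))

    power : ∀ x → IsSet x →
      ∃[ p ] IsSet p × (∀ z → z ∈ p ⇔ (IsSet z × z ⊆ x))

    infinity : ∃[ w ] IsSet w
      × (∃[ e ] IsEmpty e × e ∈ w)
      × (∀ x → x ∈ w → ∃[ s ] (∀ z → z ∈ s ⇔ (z ∈ x ⊎ z ≡ x)) × s ∈ w)

    -- F may be partial, so separation is the case of F a partial identity.
    replacement : ∀ F a → Functional F → IsSet a →
      ∃[ b ] IsSet b × (∀ y → y ∈ b ⇔ (∃[ x ] x ∈ a × ⟨ x , y ⟩∈ F))

    foundation : ∀ X → ¬ IsEmpty X →
      ∃[ y ] y ∈ X × (∀ z → z ∈ y → ¬ z ∈ X)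

    globalChoice : ∃[ F ] Functional F
      × (∀ x → IsSet x → ¬ IsEmpty x → ∃[ y ] y ∈ x × ⟨ x , y ⟩∈ F)

module _ {ℓ : Level} (M : GBC ℓ) where
  open GBC M

  V : Class
  V = proj₁ (comprehension (zero ≐′ zero) [])

  _∪_ : Class → Class → Class
  X ∪ Y = proj₁ (comprehension (zero ∈′ suc zero ∨′ zero ∈′ suc (suc zero)) (X ∷ Y ∷ []))

  -- Collections of classes are definable by an arbitrary formula (class
  -- quantifiers included) with class parameters.
  record Collection : Set ℓ where
    field
      {arity}    : ℕ
      formula    : Formula arbitrary (suc arity)
      parameters : Vec Class arity

  ⟦_⟧ : Collection → Pred Class ℓ
  ⟦ I ⟧ Y = Sat formula (Y ∷ parameters)
    where open Collection I

  record IsIdeal (X : Class) (I : Collection) : Set ℓ where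
    field
      subclasses : ∀ Y → ⟦ I ⟧ Y → Y ⊆ X
      ∪-closed   : ∀ Y₁ Y₂ → ⟦ I ⟧ Y₁ → ⟦ I ⟧ Y₂ → ⟦ I ⟧ (Y₁ ∪ Y₂)
      ⊆-closed   : ∀ Y Z → ⟦ I ⟧ Y → Z ⊆ Y → ⟦ I ⟧ Z
      proper     : ¬ ⟦ I ⟧ X

  -- Preorderings are total and, by convention, have no last element.
  record IsPreordering (X R : Class) : Set ℓ where
    field
      relation   : ∀ p → p ∈ R → ∃[ x ] ∃[ y ] x ∈ X × y ∈ X × IsOrderedPair p x y
      reflexive  : ∀ x → x ∈ X → ⟨ x , x ⟩∈ R
      transitive : ∀ x y z → ⟨ x , y ⟩∈ R → ⟨ y , z ⟩∈ R → ⟨ x , z ⟩∈ R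
      total      : ∀ x y → x ∈ X → y ∈ X → ⟨ x , y ⟩∈ R ⊎ ⟨ y , x ⟩∈ R
      noLast     : ¬ (∃[ x ] x ∈ X × (∀ y → y ∈ X → ⟨ y , x ⟩∈ R))

  Seg : Class → Class → Pred Class ℓ
  Seg X R Y = ∃[ x ] x ∈ X × (∀ y → y ∈ Y → y ∈ X × ⟨ y , x ⟩∈ R)

  Accessible : Class → Collection → Set ℓ
  Accessible X I = ∃[ R ] IsPreordering X R × Seg X R ⊆ᵖ ⟦ I ⟧

  IsAccessIdeal : Class → Collection → Set ℓ
  IsAccessIdeal X I = IsIdeal X I × Accessible X I

  IsMinimalAccessIdeal : Class → Collection → Set ℓ
  IsMinimalAccessIdeal X I = IsAccessIdeal X I
    × (∀ J → IsIdeal X J → ⟦ J ⟧ ⊂ᵖ ⟦ I ⟧ → ¬ Accessible X J)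

  -- V as an ideal: Y is in it iff Y is a member of some class, i.e. a set.
  Sets : Collection
  Sets = record { formula = ∃ᶜ (suc zero ∈′ zero) ; parameters = [] }

{-# OPTIONS --safe #-}

-- The access preordering compares ranks, but ranks are never constructed.
-- Instead the levels of the cumulative hierarchy are singled out as the members
-- of "histories": sets h whose members x are closed under subsets and consist
-- of subsets of members of x ∩ h.  The levels form a ⊆-chain and every set is
-- included in one, so "every level including y includes x" is a
-- preordering whose initial segments are sets.
--
-- Minimality: if Seg(≼) consists of sets and a set a is not in the ideal J ⊇ Seg(≼),
-- then a is cofinal, so V is the union of the sets ≼_y with y ∈ a, and hence a
-- set by replacement.
module Submission where

open import Level using (Level)
open import Data.Fin.Base using (Fin; zero; suc)
open import Data.Fin.Patterns using (0F; 1F; 2F; 3F; 4F)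
open import Data.Nat.Base using (suc; _+_)
open import Data.Product.Base using (∃-syntax; _×_; _,_; -,_; proj₁; proj₂)
open import Data.Sum.Base as Sum using (_⊎_; inj₁; inj₂; [_,_]′)
open import Data.Vec.Base using (Vec; []; _∷_; lookup)
open import Function.Base using (id; _∘_)
open import Function.Bundles using (_⇔_; mk⇔; module Equivalence)
open import Relation.Binary.PropositionalEquality
  using (_≡_; refl; sym; trans; subst)
open import Relation.Nullary using (¬_; yes; no; contradiction)
open import Relation.Nullary.Decidable using (decidable-stable)
open import Defs

open Equivalence using (to; from)

-- Predicative formulas used in comprehension.

infix 8 _⊆′_

_⊆′_ : ∀ {n} → Fin n → Fin n → Formula predicative n
i ⊆′ j = ∀ˢ (0F ∈′ suc i ⇒′ 0F ∈′ suc j)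

pair′ : ∀ {n} → Fin n → Fin n → Fin n → Formula predicative n
pair′ p x y = ∀ˢ ((0F ∈′ suc p ⇒′ either) ∧′ (either ⇒′ 0F ∈′ suc p))
  where either = 0F ≐′ suc x ∨′ 0F ≐′ suc y

orderedPair′ : ∀ {n} → Fin n → Fin n → Fin n → Formula predicative n
orderedPair′ p x y = ∃ˢ (∃ˢ
  (   pair′ 1F (suc (suc x)) (suc (suc x))
  ∧′ pair′ 0F (suc (suc x)) (suc (suc y))
  ∧′ pair′ (suc (suc p)) 1F 0F))

⟨_,_⟩∈′_ : ∀ {n} → Fin n → Fin n → Fin n → Formula predicative n
⟨ x , y ⟩∈′ r = ∃ˢ (orderedPair′ 0F (suc x) (suc y) ∧′ 0F ∈′ suc r)

-- Says that the variable belongs to some history. Only sets are quantified, so the levels form a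
-- class although no recursion on ordinals is available.
level′ : Formula predicative 1
level′ = ∃ˢ (1F ∈′ 0F ∧′ ∀ˢ (0F ∈′ 1F ⇒′
  (   ∀ˢ (0F ∈′ 1F ⇒′ ∀ˢ (0F ⊆′ 1F ⇒′ 0F ∈′ 2F))
  ∧′ ∀ˢ (0F ∈′ 1F ⇒′ ∃ˢ (0F ∈′ 2F ∧′ 0F ∈′ 3F ∧′ 1F ⊆′ 0F)))))

module _ {ℓ : Level} (M : GBC ℓ) where
  open GBC M

  -- Inclusion and membership induction.

  ∈⇒IsSet : ∀ {x X} → x ∈ X → IsSet x
  ∈⇒IsSet = -,_

  ⊆-fromSets : ∀ {X Y} → (∀ z → IsSet z → z ∈ X → z ∈ Y) → X ⊆ Y
  ⊆-fromSets f z z∈X = f z (∈⇒IsSet z∈X) z∈X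

  ⊆-toSets : ∀ {X Y} → X ⊆ Y → ∀ z → IsSet z → z ∈ X → z ∈ Y
  ⊆-toSets X⊆Y z _ = X⊆Y z

  ⊆-antisym : ∀ {X Y} → X ⊆ Y → Y ⊆ X → X ≡ Y
  ⊆-antisym X⊆Y Y⊆X = extensionality _ _ λ z → mk⇔ (X⊆Y z) (Y⊆X z)

  stable : ∀ {n} (φ : Formula predicative n) ρ → ¬ ¬ Sat φ ρ → Sat φ ρ
  stable φ ρ = decidable-stable (excludedMiddle φ ρ)

  -- Foundation is applied to the class of counterexamples, which comprehension provides because `φ`
  -- is predicative.
  ∈-induction : ∀ {n} (φ : Formula predicative (suc n)) ρ →
    (∀ x → IsSet x → (∀ y → y ∈ x → Sat φ (y ∷ ρ)) → Sat φ (x ∷ ρ)) →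
    ∀ x → IsSet x → Sat φ (x ∷ ρ)
  ∈-induction φ ρ step x x-set = stable φ (x ∷ ρ) λ ¬φx →
    let C , C-spec = comprehension (¬′ φ) ρ
        m , m∈C , minimal = foundation C λ empty → empty x (from (C-spec x) (x-set , ¬φx))
        m-set , ¬φm = to (C-spec m) m∈C
    in ¬φm (step m m-set λ y y∈m → stable φ (y ∷ ρ) λ ¬φy →
         minimal y y∈m (from (C-spec y) (∈⇒IsSet y∈m , ¬φy)))

  -- Ordered pairs

  IsPair-left : ∀ {p x y} → IsPair p x y → x ∈ p
  IsPair-left pair = from (pair _) (inj₁ refl)

  IsPair-right : ∀ {p x y} → IsPair p x y → y ∈ p
  IsPair-right pair = from (pair _) (inj₂ refl)

  IsOrderedPair-injective₁ : ∀ {p x y x′ y′} →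
    IsOrderedPair p x y → IsOrderedPair p x′ y′ → x ≡ x′
  IsOrderedPair-injective₁ (a , b , A , B , P) (a′ , b′ , A′ , B′ , P′)
    with to (P′ a) (IsPair-left P)
  ... | inj₁ refl = [ id , id ]′ (to (A′ _) (IsPair-left A))
  ... | inj₂ refl = sym ([ id , id ]′ (to (A _) (IsPair-left B′)))

  -- Used in both directions, this also settles the degenerate pairs whose two components coincide.
  second-∈ : ∀ {p x y x′ y′} →
    IsOrderedPair p x y → IsOrderedPair p x′ y′ → y ≡ x′ ⊎ y ≡ y′
  second-∈ (a , b , A , B , P) (a′ , b′ , A′ , B′ , P′)
    with to (P′ b) (IsPair-right P)
  ... | inj₁ refl = inj₁ ([ id , id ]′ (to (A′ _) (IsPair-right B)))
  ... | inj₂ refl = to (B′ _) (IsPair-right B)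

  IsOrderedPair-injective₂ : ∀ {p x y x′ y′} →
    IsOrderedPair p x y → IsOrderedPair p x′ y′ → y ≡ y′
  IsOrderedPair-injective₂ P P′
    with IsOrderedPair-injective₁ P P′ | second-∈ P P′ | second-∈ P′ P
  ... | refl | inj₂ y≡y′ | _         = y≡y′
  ... | refl | inj₁ _    | inj₂ y′≡y = sym y′≡y
  ... | refl | inj₁ y≡x  | inj₁ y′≡x = trans y≡x (sym y′≡x)

  orderedPair : ∀ x y → IsSet x → IsSet y → ∃[ p ] IsSet p × IsOrderedPair p x y
  orderedPair x y x-set y-set =
    let a , a-set , A = pairing x x x-set x-set
        b , b-set , B = pairing x y x-set y-set
        p , p-set , P = pairing a b a-set b-set
    in p , p-set , a , b , A , B , P

  -- The formula tests only sets `w`, while `IsPair` tests all classes; they agree once both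
  -- components are sets.
  Sat-pair′ : ∀ {n} (i j k : Fin n) ρ → IsSet (lookup ρ j) → IsSet (lookup ρ k) →
    Sat (pair′ i j k) ρ ⇔ IsPair (lookup ρ i) (lookup ρ j) (lookup ρ k)
  Sat-pair′ i j k ρ x-set y-set = mk⇔
    (λ P w → mk⇔ (λ w∈p → proj₁ (P w (∈⇒IsSet w∈p)) w∈p)
      λ { (inj₁ refl) → proj₂ (P w x-set) (inj₁ refl)
        ; (inj₂ refl) → proj₂ (P w y-set) (inj₂ refl) })
    (λ P w _ → to (P w) , from (P w))

  Sat-orderedPair′ : ∀ {n} (i j k : Fin n) ρ → IsSet (lookup ρ j) → IsSet (lookup ρ k) →
    Sat (orderedPair′ i j k) ρ ⇔ IsOrderedPair (lookup ρ i) (lookup ρ j) (lookup ρ k)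
  Sat-orderedPair′ i j k ρ x-set y-set = mk⇔
    (λ { (a , a-set , b , b-set , A , B , P) → a , b
       , to (Sat-pair′ 1F (suc (suc j)) (suc (suc j)) (b ∷ a ∷ ρ) x-set x-set) A
       , to (Sat-pair′ 0F (suc (suc j)) (suc (suc k)) (b ∷ a ∷ ρ) x-set y-set) B
       , to (Sat-pair′ (suc (suc i)) 1F 0F (b ∷ a ∷ ρ) a-set b-set) P })
    (λ { (a , b , A , B , P) →
       let a-set = ∈⇒IsSet (IsPair-left P)
           b-set = ∈⇒IsSet (IsPair-right P)
       in a , a-set , b , b-set
       , from (Sat-pair′ 1F (suc (suc j)) (suc (suc j)) (b ∷ a ∷ ρ) x-set x-set) A
       , from (Sat-pair′ 0F (suc (suc j)) (suc (suc k)) (b ∷ a ∷ ρ) x-set y-set) B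
       , from (Sat-pair′ (suc (suc i)) 1F 0F (b ∷ a ∷ ρ) a-set b-set) P })

  Sat-⟨,⟩∈′ : ∀ {n} (i j r : Fin n) ρ → IsSet (lookup ρ i) → IsSet (lookup ρ j) →
    Sat (⟨ i , j ⟩∈′ r) ρ ⇔ ⟨ lookup ρ i , lookup ρ j ⟩∈ lookup ρ r
  Sat-⟨,⟩∈′ i j r ρ x-set y-set = mk⇔
    (λ { (p , _ , P , p∈r) →
       p , to (Sat-orderedPair′ 0F (suc i) (suc j) (p ∷ ρ) x-set y-set) P , p∈r })
    (λ { (p , P , p∈r) →
       p , ∈⇒IsSet p∈r , from (Sat-orderedPair′ 0F (suc i) (suc j) (p ∷ ρ) x-set y-set) P , p∈r })

  -- In φ, variable 0 is the second component, variable 1 the first component,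
  -- and variable 2 the ordered pair itself.
  module Relation {n} (φ : Formula predicative (3 + n)) (ρ : Vec Class n) where
    private
      graph′ : Formula predicative (suc n)
      graph′ = ∃ˢ (∃ˢ (orderedPair′ 2F 1F 0F ∧′ φ))

    abstract
      relation : Class
      relation = proj₁ (comprehension graph′ ρ)

      ∈⇒orderedPair : ∀ p → p ∈ relation →
        ∃[ x ] ∃[ y ] IsSet x × IsSet y × IsOrderedPair p x y × Sat φ (y ∷ x ∷ p ∷ ρ)
      ∈⇒orderedPair p p∈R =
        let _ , x , x-set , y , y-set , P , sat = to (proj₂ (comprehension graph′ ρ) p) p∈R
        in x , y , x-set , y-set
           , to (Sat-orderedPair′ 2F 1F 0F (y ∷ x ∷ p ∷ ρ) x-set y-set) P , sat

      ∈⇒Sat : ∀ {x y} → ⟨ x , y ⟩∈ relation → ∃[ p ] Sat φ (y ∷ x ∷ p ∷ ρ)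
      ∈⇒Sat (p , P , p∈R) with ∈⇒orderedPair p p∈R
      ... | x , y , _ , _ , P′ , sat
          with IsOrderedPair-injective₁ P P′ | IsOrderedPair-injective₂ P P′
      ... | refl | refl = p , sat

      Sat⇒∈ : ∀ {x y} → IsSet x → IsSet y → (∀ p → Sat φ (y ∷ x ∷ p ∷ ρ)) →
        ⟨ x , y ⟩∈ relation
      Sat⇒∈ {x} {y} x-set y-set sat =
        let p , p-set , P = orderedPair x y x-set y-set
        in p , P , from (proj₂ (comprehension graph′ ρ) p)
             ( p-set , x , x-set , y , y-set
             , from (Sat-orderedPair′ 2F 1F 0F (y ∷ x ∷ p ∷ ρ) x-set y-set) P
             , sat p)

  -- Sets and proper classes

  -- `X` is the image of `a` under the identity restricted to `X`, so replacement applies.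
  IsSet-⊆ : ∀ {X a} → X ⊆ a → IsSet a → IsSet X
  IsSet-⊆ {X} {a} X⊆a a-set =
    let b , b-set , b-spec = replacement relation a functional a-set
    in subst IsSet
         (⊆-antisym
           (λ y y∈b → let x , _ , xy∈R = to (b-spec y) y∈b
                          _ , x≡y , x∈X = ∈⇒Sat xy∈R
                      in subst (_∈ X) x≡y x∈X)
           (λ y y∈X → let y-set = ∈⇒IsSet y∈X in
              from (b-spec y) (y , X⊆a y y∈X , Sat⇒∈ y-set y-set λ _ → refl , y∈X)))
         b-set
    where
    open Relation (1F ≐′ 0F ∧′ 1F ∈′ 3F) (X ∷ [])
    functional : Functional relation
    functional x y z xy xz =
      trans (sym (proj₁ (proj₂ (∈⇒Sat xy)))) (proj₁ (proj₂ (∈⇒Sat xz)))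

  ∈∪⇔ : ∀ X Y z → z ∈ _∪_ M X Y ⇔ (IsSet z × (z ∈ X ⊎ z ∈ Y))
  ∈∪⇔ X Y = proj₂ (comprehension (0F ∈′ 1F ∨′ 0F ∈′ 2F) (X ∷ Y ∷ []))

  IsSet-∪ : ∀ {X Y} → IsSet X → IsSet Y → IsSet (_∪_ M X Y)
  IsSet-∪ {X} {Y} X-set Y-set =
    let p , p-set , P = pairing X Y X-set Y-set
        u , u-set , u-spec = union p p-set
    in IsSet-⊆
         (λ z z∈X∪Y → from (u-spec z)
           ([ (λ z∈X → X , z∈X , IsPair-left P) , (λ z∈Y → Y , z∈Y , IsPair-right P) ]′
             (proj₂ (to (∈∪⇔ X Y z) z∈X∪Y))))
         u-set

  ∈V : ∀ {x} → IsSet x → x ∈ V M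
  ∈V {x} x-set = from (proj₂ (comprehension (0F ≐′ 0F) []) x) (x-set , refl)

  V-proper : ¬ IsSet (V M)
  V-proper V-set =
    -- Foundation for the singleton of `V` contradicts `V` being a member of itself.
    let s , _ , S = pairing (V M) (V M) V-set V-set
        m , m∈s , minimal = foundation s λ empty → empty (V M) (IsPair-left S)
    in minimal m (subst (m ∈_) (sym ([ id , id ]′ (to (S m) m∈s))) (∈V (∈⇒IsSet m∈s))) m∈s

  -- Levels

  -- Together the two conditions say that `x` is the union of the power sets of the members of `x`
  -- that lie in `h`.
  HistoryMember : Class → Class → Set ℓ
  HistoryMember h x =
      (∀ {c z} → c ∈ x → z ⊆ c → z ∈ x)
    × (∀ {z} → z ∈ x → ∃[ c ] c ∈ x × c ∈ h × z ⊆ c)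

  IsHistory : Class → Set ℓ
  IsHistory h = ∀ x → x ∈ h → HistoryMember h x

  abstract
    Levels : Class
    Levels = proj₁ (comprehension level′ [])

    ∈Levels⁻ : ∀ {s} → s ∈ Levels → ∃[ h ] IsSet h × s ∈ h × IsHistory h
    ∈Levels⁻ {s} s∈L =
      let _ , h , h-set , s∈h , hist = to (proj₂ (comprehension level′ []) s) s∈L
      in h , h-set , s∈h , λ x x∈h →
        let closed , accumulates = hist x (∈⇒IsSet x∈h) x∈h
        in (λ {c} {z} c∈x z⊆c → closed c (∈⇒IsSet c∈x) c∈x z (IsSet-⊆ z⊆c (∈⇒IsSet c∈x)) (⊆-toSets z⊆c))
         , λ {z} z∈x → let c , _ , c∈x , c∈h , z⊆c = accumulates z (∈⇒IsSet z∈x) z∈x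
                       in c , c∈x , c∈h , ⊆-fromSets z⊆c

    ∈Levels⁺ : ∀ {s h} → IsSet h → s ∈ h → IsHistory h → s ∈ Levels
    ∈Levels⁺ {s} {h} h-set s∈h hist = from (proj₂ (comprehension level′ []) s)
      (∈⇒IsSet s∈h , h , h-set , s∈h , λ x _ x∈h →
        let closed , accumulates = hist x x∈h
        in (λ c _ c∈x z _ z⊆c → closed c∈x (⊆-fromSets z⊆c))
         , λ z _ z∈x → let c , c∈x , c∈h , z⊆c = accumulates z∈x
                       in c , ∈⇒IsSet c∈h , c∈x , c∈h , ⊆-toSets z⊆c)

  -- A witness `c` found in a history `h` is itself a level by that same `h`. From here on
  -- individual histories can be forgotten.
  Levels-history : IsHistory Levels
  Levels-history s s∈L =
    let h , h-set , s∈h , hist = ∈Levels⁻ s∈L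
        closed , accumulates = hist s s∈h
    in closed , λ z∈s →
         let c , c∈s , c∈h , z⊆c = accumulates z∈s
         in c , c∈s , ∈Levels⁺ h-set c∈h hist , z⊆c

  level-closed : ∀ {s c z} → s ∈ Levels → c ∈ s → z ⊆ c → z ∈ s
  level-closed s∈L = proj₁ (Levels-history _ s∈L)

  level-accumulates : ∀ {s z} → s ∈ Levels → z ∈ s → ∃[ c ] c ∈ s × c ∈ Levels × z ⊆ c
  level-accumulates s∈L = proj₂ (Levels-history _ s∈L)

  level-transitive : ∀ {s c} → s ∈ Levels → c ∈ s → c ⊆ s
  level-transitive {s} {c} s∈L c∈s =
    ⊆-fromSets (∈-induction (0F ∈′ 1F ⇒′ ∀ˢ (0F ∈′ 1F ⇒′ 0F ⊆′ 1F)) (Levels ∷ []) step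
      s (∈⇒IsSet s∈L) s∈L c (∈⇒IsSet c∈s) c∈s)
    where
    step : ∀ x → IsSet x →
      (∀ y → y ∈ x → y ∈ Levels → ∀ c → IsSet c → c ∈ y → ∀ z → IsSet z → z ∈ c → z ∈ y) →
      x ∈ Levels → ∀ c → IsSet c → c ∈ x → ∀ z → IsSet z → z ∈ c → z ∈ x
    step x _ IH x∈L c _ c∈x z z-set z∈c =
      -- By induction the level `d` is transitive, so `z`, being a member of `d`, is a subset of `d`
      -- and hence a member of `x`.
      let d , d∈x , d∈L , c⊆d = level-accumulates x∈L c∈x
      in level-closed x∈L d∈x (⊆-fromSets (IH d d∈x d∈L z z-set (c⊆d z z∈c)))

  level-⊆⊎∋ : ∀ {s t} → s ∈ Levels → t ∈ Levels → s ⊆ t ⊎ t ∈ s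
  level-⊆⊎∋ {s} {t} s∈L t∈L =
    Sum.map₁ ⊆-fromSets
      (∈-induction comparable (Levels ∷ []) step s (∈⇒IsSet s∈L) s∈L t (∈⇒IsSet t∈L) t∈L)
    where
    comparable : Formula predicative 2
    comparable = 0F ∈′ 1F ⇒′ ∀ˢ (0F ∈′ 2F ⇒′ (1F ⊆′ 0F ∨′ 0F ∈′ 1F))
    step : ∀ s → IsSet s → (∀ r → r ∈ s → Sat comparable (r ∷ Levels ∷ [])) →
      Sat comparable (s ∷ Levels ∷ [])
    step s _ IH s∈L t t-set t∈L
      with excludedMiddle {predicative} (∃ˢ (0F ∈′ 1F ∧′ ¬′ 0F ∈′ 2F)) (s ∷ t ∷ [])
    ... | no s⊈t = inj₁ λ z z-set z∈s →
          stable (0F ∈′ 1F) (z ∷ t ∷ []) λ z∉t → s⊈t (z , z-set , z∈s , z∉t)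
    ... | yes (z , _ , z∈s , z∉t) with level-accumulates s∈L z∈s
    ...   | r , r∈s , r∈L , z⊆r with IH r r∈s r∈L t t-set t∈L
    ...     | inj₂ t∈r = inj₂ (level-transitive s∈L r∈s t t∈r)
    ...     | inj₁ r⊆t = inj₂ (level-closed s∈L r∈s t⊆r)
      where
      t⊆r : t ⊆ r
      -- Each `w` in `t` is included in a level `q` in `t`. If `r` were included in `q`, so would be
      -- `z`, forcing `z` into `t`; hence `q` is in `r`.
      t⊆r w w∈t with level-accumulates t∈L w∈t
      ... | q , q∈t , q∈L , w⊆q with IH r r∈s r∈L q (∈⇒IsSet q∈L) q∈L
      ...   | inj₂ q∈r = level-closed r∈L q∈r w⊆q
      ...   | inj₁ r⊆q = contradiction
              (level-closed t∈L q∈t λ v v∈z → r⊆q v (∈⇒IsSet v∈z) (z⊆r v v∈z)) z∉t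

  level-⊆⊎⊇ : ∀ {s t} → s ∈ Levels → t ∈ Levels → s ⊆ t ⊎ t ⊆ s
  level-⊆⊎⊇ s∈L t∈L = Sum.map₂ (level-transitive s∈L) (level-⊆⊎∋ s∈L t∈L)

  -- Covering sets by levels.

  abstract
    -- The level is the union of the power sets of the members of `b`, a subclass of the power set
    -- of the union of `b`.
    level-above : ∀ b → IsSet b → b ⊆ Levels →
      ∃[ s ] s ∈ Levels × (∀ {c z} → c ∈ b → z ⊆ c → z ∈ s)
    level-above b b-set b⊆L =
      let u , u-set , u-spec = union b b-set
          q , q-set , q-spec = power u u-set
          s , s-spec = comprehension (∃ˢ (0F ∈′ 2F ∧′ 1F ⊆′ 0F)) (b ∷ [])
          s-set : IsSet s
          s-set = IsSet-⊆
            (λ z z∈s → let z-set , c , _ , c∈b , z⊆c = to (s-spec z) z∈s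
                       in from (q-spec z) (z-set , λ w w∈z →
                            from (u-spec w) (c , z⊆c w (∈⇒IsSet w∈z) w∈z , c∈b)))
            q-set
          s⁺ : ∀ {c z} → c ∈ b → z ⊆ c → z ∈ s
          s⁺ {c} {z} c∈b z⊆c = from (s-spec z)
            (IsSet-⊆ z⊆c (∈⇒IsSet c∈b) , c , ∈⇒IsSet c∈b , c∈b , ⊆-toSets z⊆c)
          s⁻ : ∀ {z} → z ∈ s → ∃[ c ] c ∈ b × z ⊆ c
          s⁻ {z} z∈s = let _ , c , _ , c∈b , z⊆c = to (s-spec z) z∈s
                       in c , c∈b , ⊆-fromSets z⊆c
          closed : ∀ {c z} → c ∈ s → z ⊆ c → z ∈ s
          closed c∈s z⊆c = let d , d∈b , c⊆d = s⁻ c∈s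
                           in s⁺ d∈b λ w w∈z → c⊆d w (z⊆c w w∈z)
          -- The history witnessing that `s` is a level: the levels in `s`, together with `s`
          -- itself.
          h , h-spec = comprehension (0F ∈′ 1F ∧′ 0F ∈′ 2F ∨′ 0F ≐′ 1F) (s ∷ Levels ∷ [])
          p , p-set , P = pairing s s s-set s-set
          h-set : IsSet h
          h-set = IsSet-⊆
            (λ x x∈h → from (∈∪⇔ s p x) (∈⇒IsSet x∈h ,
              Sum.map proj₁ (λ x≡s → from (P x) (inj₁ x≡s)) (proj₂ (to (h-spec x) x∈h))))
            (IsSet-∪ s-set p-set)
          hist : IsHistory h
          hist x x∈h = [_,_]′ {C = HistoryMember h x}
            (λ (x∈s , x∈L) → level-closed x∈L , λ z∈x →
              let c , c∈x , c∈L , z⊆c = level-accumulates x∈L z∈x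
                  d , d∈b , x⊆d = s⁻ x∈s
                  -- Here `c` is a member of the level `d`, hence a subset of it by transitivity.
                  c∈s = s⁺ d∈b (level-transitive (b⊆L d d∈b) (x⊆d c c∈x))
              in c , c∈x , from (h-spec c) (∈⇒IsSet c∈x , inj₁ (c∈s , c∈L)) , z⊆c)
            (λ { refl → closed , λ z∈s →
              let c , c∈b , z⊆c = s⁻ z∈s
                  c∈s = s⁺ c∈b (λ _ → id)
              in c , c∈s , from (h-spec c) (∈⇒IsSet c∈s , inj₁ (c∈s , b⊆L c c∈b)) , z⊆c })
            (proj₂ (to (h-spec x) x∈h))
      in s , ∈Levels⁺ h-set (from (h-spec s) (s-set , inj₂ refl)) hist , s⁺

    -- Foundation yields a membership-minimal level including `x`; comparability of levels makes it
    -- least for inclusion.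
    least-level : ∀ {x} → ∃[ s ] s ∈ Levels × x ⊆ s →
      ∃[ s ] s ∈ Levels × x ⊆ s × (∀ t → t ∈ Levels → x ⊆ t → s ⊆ t)
    least-level {x} (s , s∈L , x⊆s) =
      let C , C-spec = comprehension (0F ∈′ 1F ∧′ 2F ⊆′ 0F) (Levels ∷ x ∷ [])
          m , m∈C , minimal = foundation C λ empty →
            empty s (from (C-spec s) (∈⇒IsSet s∈L , s∈L , ⊆-toSets x⊆s))
          _ , m∈L , x⊆m = to (C-spec m) m∈C
      in m , m∈L , ⊆-fromSets x⊆m , λ t t∈L x⊆t →
           [ id
           , (λ t∈m → contradiction
               (from (C-spec t) (∈⇒IsSet t∈L , t∈L , ⊆-toSets x⊆t)) (minimal t t∈m))
           ]′ (level-⊆⊎∋ m∈L t∈L)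

  -- By induction each member of `x` has a least level including it. Leastness makes this assignment
  -- functional, replacement collects these levels into a set, and a level above that set contains
  -- every member of `x`.
  level-covers : ∀ x → IsSet x → ∃[ s ] s ∈ Levels × x ⊆ s
  level-covers x x-set =
    let s , _ , s∈L , x⊆s = ∈-induction (∃ˢ (0F ∈′ 2F ∧′ 1F ⊆′ 0F)) (Levels ∷ []) step x x-set
    in s , s∈L , ⊆-fromSets x⊆s
    where
    open Relation
      (0F ∈′ 3F ∧′ 1F ⊆′ 0F ∧′ ∀ˢ (0F ∈′ 4F ⇒′ 2F ⊆′ 0F ⇒′ 1F ⊆′ 0F)) (Levels ∷ [])
    functional : Functional relation
    functional y r r′ yr yr′ =
      let _ , r∈L , y⊆r , r-least = ∈⇒Sat yr
          _ , r′∈L , y⊆r′ , r′-least = ∈⇒Sat yr′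
      in ⊆-antisym (⊆-fromSets (r-least r′ (∈⇒IsSet r′∈L) r′∈L y⊆r′))
                   (⊆-fromSets (r′-least r (∈⇒IsSet r∈L) r∈L y⊆r))
    step : ∀ x → IsSet x →
      (∀ y → y ∈ x → ∃[ s ] IsSet s × s ∈ Levels × (∀ z → IsSet z → z ∈ y → z ∈ s)) →
      ∃[ s ] IsSet s × s ∈ Levels × (∀ z → IsSet z → z ∈ x → z ∈ s)
    step x x-set IH =
      let b , b-set , b-spec = replacement relation x functional x-set
          s , s∈L , s⁺ = level-above b b-set λ r r∈b →
            let _ , _ , yr = to (b-spec r) r∈b
                _ , r∈L , _ = ∈⇒Sat yr
            in r∈L
      in s , ∈⇒IsSet s∈L , s∈L , λ y y-set y∈x →
           let t , _ , t∈L , y⊆t = IH y y∈x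
               r , r∈L , y⊆r , r-least = least-level (t , t∈L , ⊆-fromSets y⊆t)
           in s⁺ (from (b-spec r) (y , y∈x , Sat⇒∈ y-set (∈⇒IsSet r∈L) λ _ →
                   r∈L , ⊆-toSets y⊆r , λ t _ t∈L y⊆t →
                     ⊆-toSets (r-least t t∈L (⊆-fromSets y⊆t))))
                 y⊆r

  -- The rank preordering

  -- Since a set is included in exactly the levels at or above its rank, this compares ranks.
  module Rank =
    Relation (∀ˢ (0F ∈′ 4F ⇒′ 1F ⊆′ 0F ⇒′ 2F ⊆′ 0F)) (Levels ∷ [])

  _≼_ : Class → Class → Set ℓ
  x ≼ y = ⟨ x , y ⟩∈ Rank.relation

  ≼⁺ : ∀ {x y} → IsSet x → IsSet y → (∀ s → s ∈ Levels → y ⊆ s → x ⊆ s) → x ≼ y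
  ≼⁺ x-set y-set f = Rank.Sat⇒∈ x-set y-set λ _ s _ s∈L y⊆s →
    ⊆-toSets (f s s∈L (⊆-fromSets y⊆s))

  ≼⁻ : ∀ {x y s} → x ≼ y → s ∈ Levels → y ⊆ s → x ⊆ s
  ≼⁻ x≼y s∈L y⊆s =
    ⊆-fromSets (proj₂ (Rank.∈⇒Sat x≼y) _ (∈⇒IsSet s∈L) s∈L (⊆-toSets y⊆s))

  ≼-fields : ∀ {x y} → x ≼ y → IsSet x × IsSet y
  ≼-fields (p , P , p∈R) with Rank.∈⇒orderedPair p p∈R
  ... | x , y , x-set , y-set , P′ , _
      with IsOrderedPair-injective₁ P P′ | IsOrderedPair-injective₂ P P′
  ... | refl | refl = x-set , y-set

  ≼-transitive : ∀ x y z → x ≼ y → y ≼ z → x ≼ z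
  ≼-transitive x y z x≼y y≼z =
    ≼⁺ (proj₁ (≼-fields x≼y)) (proj₂ (≼-fields y≼z)) λ s s∈L z⊆s →
      ≼⁻ x≼y s∈L (≼⁻ y≼z s∈L z⊆s)

  ≼-total : ∀ x y → IsSet x → IsSet y → x ≼ y ⊎ y ≼ x
  ≼-total x y x-set y-set
    with excludedMiddle {predicative}
           (∃ˢ (0F ∈′ 1F ∧′ 3F ⊆′ 0F ∧′ ¬′ (2F ⊆′ 0F))) (Levels ∷ x ∷ y ∷ [])
  ... | no none = inj₁ (≼⁺ x-set y-set λ s s∈L y⊆s → ⊆-fromSets
          (stable (0F ⊆′ 1F) (x ∷ s ∷ []) λ x⊈s →
            none (s , ∈⇒IsSet s∈L , s∈L , ⊆-toSets y⊆s , x⊈s)))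
  -- The level `s` includes `y` but not `x`, so a level `t` including `x` cannot be below `s`; thus
  -- `t` includes `s` and with it `y`.
  ... | yes (s , _ , s∈L , y⊆s , x⊈s) = inj₂ (≼⁺ y-set x-set λ t t∈L x⊆t →
          [ (λ s⊆t z z∈y → s⊆t z (y⊆s z (∈⇒IsSet z∈y) z∈y))
          , (λ t⊆s → contradiction (λ z _ z∈x → t⊆s z (x⊆t z z∈x)) x⊈s)
          ]′ (level-⊆⊎⊇ s∈L t∈L))

  -- A level including `x` includes every member of `Y`, so `Y` lies in its power set.
  ≼-bounded⇒IsSet : ∀ {Y} x → IsSet x → (∀ y → y ∈ Y → y ≼ x) → IsSet Y
  ≼-bounded⇒IsSet x x-set Y≼x =
    let s , s∈L , x⊆s = level-covers x x-set
        q , q-set , q-spec = power s (∈⇒IsSet s∈L)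
    in IsSet-⊆ (λ y y∈Y → from (q-spec y) (∈⇒IsSet y∈Y , ≼⁻ (Y≼x y y∈Y) s∈L x⊆s)) q-set

  -- The sets form an access ideal.

  Sets-ideal : IsIdeal M (V M) (Sets M)
  Sets-ideal = record
    { subclasses = λ _ _ z z∈Y → ∈V (∈⇒IsSet z∈Y)
    ; ∪-closed   = λ _ _ → IsSet-∪
    ; ⊆-closed   = λ _ _ Y-set Z⊆Y → IsSet-⊆ Z⊆Y Y-set
    ; proper     = V-proper
    }

  Sets-accessible : Accessible M (V M) (Sets M)
  Sets-accessible = Rank.relation , preordering , λ (x , x∈V , bound) →
      ≼-bounded⇒IsSet x (∈⇒IsSet x∈V) λ y → proj₂ ∘ bound y
    where
    preordering : IsPreordering M (V M) Rank.relation
    preordering = record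
      { relation   = λ p p∈R →
          let x , y , x-set , y-set , P , _ = Rank.∈⇒orderedPair p p∈R
          in x , y , ∈V x-set , ∈V y-set , P
      ; reflexive  = λ _ x∈V → ≼⁺ (∈⇒IsSet x∈V) (∈⇒IsSet x∈V) λ _ _ → id
      ; transitive = ≼-transitive
      ; total      = λ x y x∈V y∈V → ≼-total x y (∈⇒IsSet x∈V) (∈⇒IsSet y∈V)
      ; noLast     = λ (x , x∈V , last) → V-proper (≼-bounded⇒IsSet x (∈⇒IsSet x∈V) last)
      }

  -- Minimality

  -- The map from `i` to its segment is functional by extensionality, so the segments form a set,
  -- whose union covers `X`.
  IsSet-⋃ : ∀ (R : Class) {a} → IsSet a →
    (∀ i → i ∈ a → ∃[ D ] IsSet D × (∀ z → IsSet z → z ∈ D ⇔ ⟨ z , i ⟩∈ R)) →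
    ∀ {X} → (∀ z → z ∈ X → ∃[ i ] i ∈ a × ⟨ z , i ⟩∈ R) → IsSet X
  IsSet-⋃ R {a} a-set segment covered =
    let b , b-set , b-spec = replacement relation a functional a-set
        u , u-set , u-spec = union b b-set
    in IsSet-⊆
         (λ z z∈X →
           let i , i∈a , zi∈R = covered z z∈X
               D , D-set , D-spec = segment i i∈a
               i-set = ∈⇒IsSet i∈a
               iD : ⟨ i , D ⟩∈ relation
               iD = Sat⇒∈ i-set D-set λ p w w-set →
                 let e = Sat-⟨,⟩∈′ 0F 2F 4F (w ∷ D ∷ i ∷ p ∷ R ∷ []) w-set i-set
                 in (λ w∈D → from e (to (D-spec w w-set) w∈D)) , (λ wi → from (D-spec w w-set) (to e wi))
           in from (u-spec z)
                (D , from (D-spec z (∈⇒IsSet z∈X)) zi∈R , from (b-spec D) (i , i∈a , iD)))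
         u-set
    where
    open Relation (∀ˢ ((0F ∈′ 1F ⇒′ ⟨ 0F , 2F ⟩∈′ 4F) ∧′ (⟨ 0F , 2F ⟩∈′ 4F ⇒′ 0F ∈′ 1F)))
      (R ∷ [])
    functional : Functional relation
    functional i D E iD iE =
      let _ , D-sat = ∈⇒Sat iD
          _ , E-sat = ∈⇒Sat iE
      in ⊆-antisym
           (⊆-fromSets λ w w-set w∈D → proj₂ (E-sat w w-set) (proj₁ (D-sat w w-set) w∈D))
           (⊆-fromSets λ w w-set w∈E → proj₂ (D-sat w w-set) (proj₁ (E-sat w w-set) w∈E))

  cofinal⇒¬IsSet : ∀ {R a} → IsPreordering M (V M) R → (∀ Y → Seg M (V M) R Y → IsSet Y) →
    ¬ Seg M (V M) R a → ¬ IsSet a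
  cofinal⇒¬IsSet {R} {a} preordering Seg⊆Sets cofinal a-set =
    V-proper (IsSet-⋃ R a-set segment covered)
    where
    open IsPreordering preordering
    segment : ∀ i → i ∈ a → ∃[ D ] IsSet D × (∀ z → IsSet z → z ∈ D ⇔ ⟨ z , i ⟩∈ R)
    segment i i∈a =
      let i-set = ∈⇒IsSet i∈a
          D , D-spec = comprehension (⟨ 0F , 1F ⟩∈′ 2F) (i ∷ R ∷ [])
          pairs z z-set = Sat-⟨,⟩∈′ 0F 1F 2F (z ∷ i ∷ R ∷ []) z-set i-set
          D⁻ z z∈D = to (pairs z (∈⇒IsSet z∈D)) (proj₂ (to (D-spec z) z∈D))
      in D , Seg⊆Sets D (i , ∈V i-set , λ z z∈D → ∈V (∈⇒IsSet z∈D) , D⁻ z z∈D)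
         , λ z z-set → mk⇔ (D⁻ z) λ zi → from (D-spec z) (z-set , from (pairs z z-set) zi)
    covered : ∀ x → x ∈ V M → ∃[ i ] i ∈ a × ⟨ x , i ⟩∈ R
    covered x x∈V =
      let x-set = ∈⇒IsSet x∈V
          -- If no member of `a` were above `x`, totality would make `x` a bound for `a`.
          i , i-set , i∈a , xi = stable (∃ˢ (0F ∈′ 2F ∧′ ⟨ 1F , 0F ⟩∈′ 3F)) (x ∷ a ∷ R ∷ []) λ none →
            cofinal (x , x∈V , λ i i∈a → let i-set = ∈⇒IsSet i∈a in ∈V i-set ,
              [ (λ xi → contradiction
                  (i , i-set , i∈a , from (Sat-⟨,⟩∈′ 1F 0F 3F (i ∷ x ∷ a ∷ R ∷ []) x-set i-set) xi) none)
              , id ]′ (total x i x∈V (∈V i-set)))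
      in i , i∈a , to (Sat-⟨,⟩∈′ 1F 0F 3F (i ∷ x ∷ a ∷ R ∷ []) x-set i-set) xi

theorem2p3 : ∀ {ℓ : Level} (M : GBC ℓ) → IsMinimalAccessIdeal M (V M) (Sets M)
theorem2p3 M = (Sets-ideal M , Sets-accessible M) ,
  -- Strictness is refuted by putting every set `a` into `J`: outside `J` it would be unbounded,
  -- hence not a set.
  λ J _ (J⊆Sets , Sets⊈J) (_ , preordering , Seg⊆J) → Sets⊈J λ {a} a-set →
    decidable-stable (excludedMiddle (Collection.formula J) (a ∷ Collection.parameters J)) λ a∉J →
      cofinal⇒¬IsSet M preordering (λ _ → J⊆Sets ∘ Seg⊆J) (a∉J ∘ Seg⊆J) a-set
  where open GBC M
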